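{- Let $(W,R)$ be an $L5$-frame, let $g\colon V\to\mathrm{Pow}(W)$ be an assignment in $(W,R)$, and let $w_T\in W$ be an $R$-maximal element of $W$. Then there exist an $L5$-model $\mathcal{M}$ and an assignment $\gamma\colon V\to M$ such that for all formulas $\varphi$: $$(\mathcal{M},\gamma)\vDash\varphi\iff (w_T,g)\vDash\varphi.$$
   Context: Formulas are built from a countable set $V$ of propositional variables using $\wedge,\vee,\rightarrow,\bot$ and the unary modal operator $\square$; $\top$ abbreviates $\bot\rightarrow\bot$. An $L5$-frame is a pair $(W,R)$ with the following properties: - $W$ is a non-empty set; - $R$ is a partial order on $W$; - there is an $R$-smallest element $w_B$ (the bottom world); - every $R$-chain has an upper bound in $W$. An assignment in $(W,R)$ is a map $g\colon V\to\mathrm{Pow}(W)$ with $wRw'$ and $w\in g(x)$ implying $w'\in g(x)$. Kripke satisfaction is defined as follows: - $(w,g)\nvDash\bot$; - $(w,g)\vDash x$ iff $w\in g(x)$; - $\vee,\wedge$ are evaluated pointwise; - $(w,g)\vDash\varphi\rightarrow\psi$ iff for all $w'$ with $wRw'$, $(w',g)\vDash\varphi$ implies $(w',g)\vDash\psi$; - $(w,g)\vDash\square\varphi$ iff $(w_B,g)\vDash\varphi$. An $L5$-model is a structure $\mathcal{M}=(M,\mathit{TRUE},f_\bot,f_\top,f_\rightarrow,f_\vee,f_\wedge,f_\square)$ such that $(M,f_\bot,f_\top,f_\rightarrow,f_\vee,f_\wedge)$ is a Heyting algebra (lattice order $\le$). Moreover, $\mathit{TRUE}\subseteq M$ is an ultrafilter,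 and $f_\square\colon M\to M$ satisfies, for all $m,m',m''\in M$: (i) $f_\square(m)\le m$; (ii) $f_\square(f_\rightarrow(m,m'))\le f_\rightarrow(f_\square(f_\rightarrow(m',m'')),f_\square(f_\rightarrow(m,m'')))$; (iii) $f_\square(f_\vee(m,m'))\le f_\vee(f_\square(m),f_\square(m'))$; (iv) $f_\square(m)\in\mathit{TRUE}$ iff $m=f_\top$; (v) $f_\square(m)=f_\top$ if $m=f_\top$, and $f_\square(m)=f_\bot$ otherwise. An assignment $\gamma\colon V\to M$ extends to all formulas by: - $\gamma(\bot)=f_\bot$; - $\gamma(\square\varphi)=f_\square(\gamma(\varphi))$; - $\gamma(\varphi*\psi)=f_*(\gamma(\varphi),\gamma(\psi))$ for $*\in\{\vee,\wedge,\rightarrow\}$. Satisfaction is $(\mathcal{M},\gamma)\vDash\varphi$ iff $\gamma(\varphi)\in\mathit{TRUE}$. -}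

module Defs where

open import Algebra.Definitions using (Congruent₁)
open import Data.Empty.Polymorphic using (⊥)
open import Data.Product using (_×_; ∃)
open import Data.Sum using (_⊎_)
open import Function.Bundles using (_⇔_)
open import Level using (Level; suc)
open import Relation.Binary.Core using (Rel)
open import Relation.Binary.Definitions using (Minimum; _Respects_)
open import Relation.Binary.Lattice.Bundles using (HeytingAlgebra)
open import Relation.Binary.PropositionalEquality using (_≡_)
open import Relation.Binary.Structures using (IsPartialOrder)
open import Relation.Nullary using (¬_)
open import Relation.Unary using (Pred; _∈_; _∉_; _⊆_; Satisfiable)

private
  variable
    ℓ : Level

infixr 5 _⇒_
infixr 6 _∨_
infixr 7 _∧_
infix  8 □_

data Formula (V : Set ℓ) : Set ℓ where
  var : V → Formula V
  ⊥′  : Formula V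
  _∧_ : Formula V → Formula V → Formula V
  _∨_ : Formula V → Formula V → Formula V
  _⇒_ : Formula V → Formula V → Formula V
  □_  : Formula V → Formula V

IsChain : {A : Set ℓ} → Rel A ℓ → Pred A ℓ → Set ℓ
IsChain _R_ C = ∀ {x y} → x ∈ C → y ∈ C → x R y ⊎ y R x

UpperBound : {A : Set ℓ} → Rel A ℓ → Pred A ℓ → A → Set ℓ
UpperBound _R_ C u = ∀ {x} → x ∈ C → x R u

Maximal : {A : Set ℓ} → Rel A ℓ → A → Set ℓ
Maximal _R_ m = ∀ w → m R w → w ≡ m

-- Non-emptiness of W is witnessed by the bottom world.
record L5Frame (ℓ : Level) : Set (suc ℓ) where
  infix 4 _R_
  field
    W              : Set ℓ
    _R_            : Rel W ℓ
    isPartialOrder : IsPartialOrder _≡_ _R_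
    w-B            : W
    w-B-minimum    : Minimum _R_ w-B
    chain-bounded  : ∀ (C : Pred W ℓ) → IsChain _R_ C → ∃ (UpperBound _R_ C)

module _ (F : L5Frame ℓ) where
  open L5Frame F

  record FrameAssignment (V : Set ℓ) : Set (suc ℓ) where
    field
      val      : V → Pred W ℓ
      monotone : ∀ x → val x Respects _R_

module _ {F : L5Frame ℓ} {V : Set ℓ} where
  open L5Frame F
  open FrameAssignment

  infix 4 ⟨_,_⟩⊩_

  ⟨_,_⟩⊩_ : W → FrameAssignment F V → Formula V → Set ℓ
  ⟨ w , g ⟩⊩ var x = w ∈ val g x
  ⟨ w , g ⟩⊩ ⊥′    = ⊥
  ⟨ w , g ⟩⊩ φ ∧ ψ = (⟨ w , g ⟩⊩ φ) × (⟨ w , g ⟩⊩ ψ)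
  ⟨ w , g ⟩⊩ φ ∨ ψ = (⟨ w , g ⟩⊩ φ) ⊎ (⟨ w , g ⟩⊩ ψ)
  ⟨ w , g ⟩⊩ φ ⇒ ψ = ∀ w′ → w R w′ → ⟨ w′ , g ⟩⊩ φ → ⟨ w′ , g ⟩⊩ ψ
  ⟨ w , g ⟩⊩ □ φ   = ⟨ w-B , g ⟩⊩ φ

module _ (H : HeytingAlgebra ℓ ℓ ℓ) where
  private module H = HeytingAlgebra H

  record IsProperFilter (F : Pred H.Carrier ℓ) : Set ℓ where
    field
      nonempty      : Satisfiable F
      upward-closed : F Respects H._≤_
      ∧-closed      : ∀ {a b} → a ∈ F → b ∈ F → (a H.∧ b) ∈ F
      proper        : H.⊥ ∉ F

  record IsUltrafilter (F : Pred H.Carrier ℓ) : Set (suc ℓ) where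
    field
      isProperFilter : IsProperFilter F
      maximal        : ∀ (G : Pred H.Carrier ℓ) → IsProperFilter G → F ⊆ G → G ⊆ F

-- The Heyting algebra carries a setoid equality _≈_, which plays the role of
-- equality of elements of M; hence the congruence law f□-cong.
record L5Model (ℓ : Level) : Set (suc ℓ) where
  field
    heytingAlgebra : HeytingAlgebra ℓ ℓ ℓ
  open HeytingAlgebra heytingAlgebra public
    using (_≈_; _≤_)
    renaming ( Carrier to M; ⊥ to f⊥; ⊤ to f⊤
             ; _⇨_ to infixr 5 _f⇒_; _∨_ to infixr 6 _f∨_; _∧_ to infixr 7 _f∧_)
  field
    TRUE           : Pred M ℓ
    isUltrafilter  : IsUltrafilter heytingAlgebra TRUE
    f□             : M → M
    f□-cong        : Congruent₁ _≈_ f□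
    f□-decreasing  : ∀ m → f□ m ≤ m
    f□-trans       : ∀ m m′ m″ → f□ (m f⇒ m′) ≤ f□ (m′ f⇒ m″) f⇒ f□ (m f⇒ m″)
    f□-∨           : ∀ m m′ → f□ (m f∨ m′) ≤ f□ m f∨ f□ m′
    f□-TRUE        : ∀ m → f□ m ∈ TRUE ⇔ m ≈ f⊤
    f□-top         : ∀ m → m ≈ f⊤ → f□ m ≈ f⊤
    f□-nontop      : ∀ m → ¬ (m ≈ f⊤) → f□ m ≈ f⊥

module _ (𝓜 : L5Model ℓ) {V : Set ℓ} where
  open L5Model 𝓜

  ⟦_⟧ : Formula V → (V → M) → M
  ⟦ var x ⟧ γ = γ x
  ⟦ ⊥′ ⟧    γ = f⊥
  ⟦ φ ∧ ψ ⟧ γ = ⟦ φ ⟧ γ f∧ ⟦ ψ ⟧ γ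
  ⟦ φ ∨ ψ ⟧ γ = ⟦ φ ⟧ γ f∨ ⟦ ψ ⟧ γ
  ⟦ φ ⇒ ψ ⟧ γ = ⟦ φ ⟧ γ f⇒ ⟦ ψ ⟧ γ
  ⟦ □ φ ⟧   γ = f□ (⟦ φ ⟧ γ)

infix 4 ⟨_,_⟩⊨_

⟨_,_⟩⊨_ : (𝓜 : L5Model ℓ) {V : Set ℓ} → (V → L5Model.M 𝓜) → Formula V → Set ℓ
⟨ 𝓜 , γ ⟩⊨ φ = ⟦_⟧ 𝓜 φ γ ∈ L5Model.TRUE 𝓜

{-# OPTIONS --safe #-}

-- The formulas themselves, preordered by φ ≤ ψ iff φ forces ψ at every world,
-- form a Heyting algebra (of definable up-sets) in which □ is either top or
-- bottom, because truth at w-B is truth everywhere. Truth at a maximal world is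
-- a prime filter containing φ or ¬ φ for each φ, hence an ultrafilter, and under
-- the assignment x ↦ x every formula denotes itself. Working with definable
-- rather than arbitrary up-sets keeps the carrier in Set ℓ.
module Submission where

open import Defs
open import Axiom.ExcludedMiddle using (ExcludedMiddle)
open import Data.Empty.Polymorphic using (⊥-elim)
open import Data.Nat.Base using (ℕ)
open import Data.Product using (Σ-syntax; _,_; proj₁; proj₂)
import Data.Product as Product
open import Data.Sum using (inj₁; inj₂; [_,_])
import Data.Sum as Sum
open import Function.Base using (id)
open import Function.Bundles using (_⇔_; _↣_; mk⇔)
open import Function.Related.Propositional using (≡⇒; equivalence)
open import Level using (Level)
open import Relation.Binary.Construct.Interior.Symmetric
  using (SymInterior; _,_; lhs≤rhs; rhs≤lhs) renaming (isPartialOrder to symInterior-isPartialOrder)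
open import Relation.Binary.Core using (Rel)
open import Relation.Binary.Lattice.Bundles using (HeytingAlgebra)
open import Relation.Binary.PropositionalEquality using (_≡_; refl; cong; cong₂; subst)
open import Relation.Binary.Structures using (IsPartialOrder)
open import Relation.Nullary using (¬_; contradiction)
open import Relation.Nullary.Decidable using (decidable-stable)

private
  variable
    ℓ : Level

module FormulaAlgebra {V : Set ℓ} (F : L5Frame ℓ) (g : FrameAssignment F V) where
  open L5Frame F
  private module R = IsPartialOrder isPartialOrder

  infix 4 _⊩_ _≤_

  _⊩_ : W → Formula V → Set ℓ
  w ⊩ φ = ⟨ w , g ⟩⊩ φ

  ⊩-persistent : ∀ φ {w w′} → w R w′ → w ⊩ φ → w′ ⊩ φ
  ⊩-persistent (var x) r p = FrameAssignment.monotone g x r p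
  ⊩-persistent (φ ∧ ψ) r p = Product.map (⊩-persistent φ r) (⊩-persistent ψ r) p
  ⊩-persistent (φ ∨ ψ) r p = Sum.map (⊩-persistent φ r) (⊩-persistent ψ r) p
  ⊩-persistent (φ ⇒ ψ) r p = λ w″ r′ → p w″ (R.trans r r′)
  ⊩-persistent (□ φ)   r p = p

  _≤_ : Rel (Formula V) ℓ
  φ ≤ ψ = ∀ w → w ⊩ φ → w ⊩ ψ

  ⊤′ : Formula V
  ⊤′ = ⊥′ ⇒ ⊥′

  ⊩-⊤ : ∀ w → w ⊩ ⊤′
  ⊩-⊤ w w′ _ p = p

  heytingAlgebra : HeytingAlgebra ℓ ℓ ℓ
  heytingAlgebra = record
    { Carrier = Formula V
    -- Mutual entailment as equality makes `_≤_` antisymmetric without forming a quotient, as in a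
    -- Lindenbaum algebra.
    ; _≈_ = SymInterior _≤_
    ; _≤_ = _≤_
    ; _∨_ = _∨_
    ; _∧_ = _∧_
    ; _⇨_ = _⇒_
    ; ⊤ = ⊤′
    ; ⊥ = ⊥′
    ; isHeytingAlgebra = record
      { isBoundedLattice = record
        { isLattice = record
          { isPartialOrder = symInterior-isPartialOrder
              (λ _ → id) (λ φ≤ψ ψ≤χ w p → ψ≤χ w (φ≤ψ w p))
          ; supremum = λ φ ψ → (λ _ → inj₁) , (λ _ → inj₂) ,
              λ χ φ≤χ ψ≤χ w → [ φ≤χ w , ψ≤χ w ]
          ; infimum = λ φ ψ → (λ _ → proj₁) , (λ _ → proj₂) ,
              λ χ χ≤φ χ≤ψ w p → χ≤φ w p , χ≤ψ w p
          }
        ; maximum = λ φ w _ → ⊩-⊤ w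
        ; minimum = λ φ w → ⊥-elim
        }
      ; exponential = λ φ ψ χ →
          -- Currying has to carry `p` from `w` up to the later world `w′`, hence persistence;
          -- uncurrying evaluates the implication at `w` itself.
          (λ φ∧ψ≤χ w p w′ r q → φ∧ψ≤χ w′ (⊩-persistent φ r p , q)) ,
          (λ φ≤ψ⇒χ w (p , q) → φ≤ψ⇒χ w p w R.refl q)
      }
    }

  open HeytingAlgebra heytingAlgebra using (_≈_)

  ⊩-w-B⇒≈⊤ : ∀ φ → w-B ⊩ φ → φ ≈ ⊤′
  ⊩-w-B⇒≈⊤ φ p = (λ w _ → ⊩-⊤ w) , (λ w _ → ⊩-persistent φ (w-B-minimum w) p)

  ≈⊤⇒⊩ : ∀ φ → φ ≈ ⊤′ → ∀ w → w ⊩ φ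
  ≈⊤⇒⊩ φ φ≈⊤ w = rhs≤lhs φ≈⊤ w (⊩-⊤ w)

  module _ (w : W) where

    theory-isProperFilter : IsProperFilter heytingAlgebra (w ⊩_)
    theory-isProperFilter = record
      { nonempty      = ⊤′ , ⊩-⊤ w
      ; upward-closed = λ φ≤ψ → φ≤ψ w
      ; ∧-closed      = _,_
      ; proper        = λ ()
      }

    module _ (em : ExcludedMiddle ℓ) (w-maximal : Maximal _R_ w) where

      -- The only world above a maximal `w` is `w` itself, so failure at `w` already refutes `φ` at
      -- every successor.
      ⊮⇒⊩¬ : ∀ φ → ¬ (w ⊩ φ) → w ⊩ φ ⇒ ⊥′
      ⊮⇒⊩¬ φ ¬p w′ r q = contradiction (subst (_⊩ φ) (w-maximal w′ r) q) ¬p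

      theory-isUltrafilter : IsUltrafilter heytingAlgebra (w ⊩_)
      theory-isUltrafilter = record
        { isProperFilter = theory-isProperFilter
        ; maximal        = λ G G-filter theory⊆G {φ} φ∈G →
            let open IsProperFilter G-filter in
            -- If `φ` failed at `w`, its negation would lie in the theory of `w`, hence in `G`; then
            -- `G` would contain `φ ∧ (φ ⇒ ⊥′)`, which lies below `⊥′`.
            decidable-stable em λ ¬p → proper
              (upward-closed {φ ∧ (φ ⇒ ⊥′)} (λ w′ (p , ¬p′) → ¬p′ w′ R.refl p)
                (∧-closed φ∈G (theory⊆G {φ ⇒ ⊥′} (⊮⇒⊩¬ φ ¬p))))
        }

      formulaModel : L5Model ℓ
      formulaModel = record
        { heytingAlgebra = heytingAlgebra
        ; TRUE           = w ⊩_
        ; isUltrafilter  = theory-isUltrafilter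
        ; f□             = □_
        ; f□-cong        = λ φ≈ψ → (λ _ → lhs≤rhs φ≈ψ w-B) , (λ _ → rhs≤lhs φ≈ψ w-B)
        ; f□-decreasing  = λ φ w′ → ⊩-persistent φ (w-B-minimum w′)
        -- Both boxed premises speak of `w-B`, wherever they are assumed, so the two implications
        -- compose at any `w′` above it.
        ; f□-trans       = λ _ _ _ _ φ⇒ψ _ _ ψ⇒χ w′ r p → ψ⇒χ w′ r (φ⇒ψ w′ r p)
        ; f□-∨           = λ _ _ _ → id
        -- Membership of `□ φ` in `TRUE` unfolds to `w-B ⊩ φ`, whatever `w` is.
        ; f□-TRUE        = λ φ → mk⇔ (⊩-w-B⇒≈⊤ φ) (λ φ≈⊤ → ≈⊤⇒⊩ φ φ≈⊤ w-B)
        ; f□-top         = λ φ φ≈⊤ → ⊩-w-B⇒≈⊤ (□ φ) (≈⊤⇒⊩ φ φ≈⊤ w-B)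
        ; f□-nontop      = λ φ φ≉⊤ →
            (λ _ p → contradiction (⊩-w-B⇒≈⊤ φ p) φ≉⊤) , (λ _ → ⊥-elim)
        }

      -- The operations of the model are the formula constructors, so evaluation under `var` is the
      -- identity substitution. The equality is syntactic, so `cong` carries it through forcing.
      ⟦⟧-var : ∀ φ → ⟦_⟧ formulaModel φ var ≡ φ
      ⟦⟧-var (var x) = refl
      ⟦⟧-var ⊥′      = refl
      ⟦⟧-var (φ ∧ ψ) = cong₂ _∧_ (⟦⟧-var φ) (⟦⟧-var ψ)
      ⟦⟧-var (φ ∨ ψ) = cong₂ _∨_ (⟦⟧-var φ) (⟦⟧-var ψ)
      ⟦⟧-var (φ ⇒ ψ) = cong₂ _⇒_ (⟦⟧-var φ) (⟦⟧-var ψ)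
      ⟦⟧-var (□ φ)   = cong □_ (⟦⟧-var φ)

theorem5p3 : {ℓ : Level} → ExcludedMiddle ℓ →
    (V : Set ℓ) → V ↣ ℕ →
    (F : L5Frame ℓ) (g : FrameAssignment F V)
    (w-T : L5Frame.W F) → Maximal (L5Frame._R_ F) w-T →
    Σ[ 𝓜 ∈ L5Model ℓ ] Σ[ γ ∈ (V → L5Model.M 𝓜) ]
    ((φ : Formula V) → (⟨ 𝓜 , γ ⟩⊨ φ) ⇔ (⟨ w-T , g ⟩⊩ φ))
theorem5p3 em V _ F g w-T w-T-maximal =
  formulaModel w-T em w-T-maximal , var ,
  λ φ → ≡⇒ {k = equivalence} (cong (w-T ⊩_) (⟦⟧-var w-T em w-T-maximal φ))
  where open FormulaAlgebra F g
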